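{- Let $N\ge 2$ and let $S$ be a set of $N$ pairwise distinct items, totally ordered by $<$. Suppose that the items of $S$ arrive in uniformly random order $I_1,I_2,\dots,I_N$. Let $b=1$ if $I_1<I_2$ and $b=0$ otherwise. Then $b$ is an unbiased bit: $\Pr[b=1]=\Pr[b=0]=\tfrac12$.
   Context: Items are represented by vectors in $\mathbb{R}^d$ for some $d\ge1$ and are ordered lexicographically, so that any set of pairwise distinct items is totally ordered. -}

module Defs where

open import Data.Bool.Base using (if_then_else_)
open import Data.Digit using (Bit; 0b; 1b)
open import Data.Fin.Base using (Fin; zero; suc; inject≤)
open import Data.Fin.Patterns using (0F; 1F)
open import Data.Fin.Permutation as Perm
  using (Permutation′; _⟨$⟩ʳ_; insert; remove; insert-remove)
open import Data.Fin.Properties using (_≟_; punchIn-injective)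
open import Data.Integer.Base using (+_)
open import Data.List.Base
  using (List; [_]; length; filter; allFin; cartesianProductWith)
open import Data.List.Membership.Propositional.Properties using (∈-allFin)
open import Data.List.Membership.Setoid.Properties
  using (∈-cartesianProductWith⁺; ∈-resp-≈; ∈-length)
open import Data.List.Relation.Unary.All using ([])
open import Data.List.Relation.Unary.AllPairs.Core using ([]; _∷_)
open import Data.List.Relation.Unary.Any using (here)
open import Data.List.Relation.Unary.Enumerates.Setoid using (IsEnumeration)
open import Data.List.Relation.Unary.Unique.Propositional.Properties using (allFin⁺)
open import Data.List.Relation.Unary.Unique.Setoid using (Unique)
open import Data.List.Relation.Unary.Unique.Setoid.Properties
  using (cartesianProductWith⁺)
open import Data.Nat.Base using (ℕ; zero; suc; _≤_; NonZero; >-nonZero)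
open import Data.Product.Base using (_×_; _,_)
open import Data.Rational.Base using (ℚ; _/_)
open import Function.Bundles using (Func)
open import Level using (Level; 0ℓ) renaming (suc to lsuc; _⊔_ to _⊔ˡ_)
open import Relation.Binary.Bundles using (Setoid; StrictTotalOrder)
open import Relation.Binary.PropositionalEquality
  using (_≡_; refl; sym; trans; cong; cong₂; setoid)
open import Relation.Nullary.Decidable using (does)

-- A finite nonempty sample space with the uniform distribution.  Outcomes are
-- compared by a setoid equality because permutations are functions; the list
-- contains each outcome exactly once up to that equality.
record UniformSpace c ℓ : Set (lsuc (c ⊔ˡ ℓ)) where
  field
    outcome    : Setoid c ℓ
    outcomes   : List (Setoid.Carrier outcome)
    complete   : IsEnumeration outcome outcomes
    distinct   : Unique outcome outcomes
    nonEmpty   : NonZero (length outcomes)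

  RandomVariable : Set → Set (c ⊔ˡ ℓ)
  RandomVariable B = Func outcome (setoid B)

  Pr[_≡_] : RandomVariable Bit → Bit → ℚ
  Pr[ X ≡ v ] =
    _/_ (+ length (filter (λ ω → Func.to X ω ≟ v) outcomes))
        (length outcomes) {{nonEmpty}}

permutationSetoid : ℕ → Setoid 0ℓ 0ℓ
permutationSetoid n = record
  { Carrier       = Permutation′ n
  ; _≈_           = Perm._≈_
  ; isEquivalence = record
    { refl  = λ _ → refl
    ; sym   = λ p i → sym (p i)
    ; trans = λ p q i → trans (p i) (q i)
    }
  }

permutations : ∀ n → List (Permutation′ n)
permutations zero    = [ Perm.id ]
permutations (suc n) =
  cartesianProductWith (insert zero) (allFin (suc n)) (permutations n)

insert-cong : ∀ {n} {j k : Fin (suc n)} {π ρ : Permutation′ n} →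
              j ≡ k → π Perm.≈ ρ → insert zero j π Perm.≈ insert zero k ρ
insert-cong j≡k π≈ρ zero    = j≡k
insert-cong refl π≈ρ (suc i) rewrite π≈ρ i = refl

insert-injective : ∀ {n} {j k : Fin (suc n)} {π ρ : Permutation′ n} →
                   insert zero j π Perm.≈ insert zero k ρ → j ≡ k × π Perm.≈ ρ
insert-injective eq with refl ← eq zero =
  refl , λ i → punchIn-injective _ _ _ (eq (suc i))

permutations-complete : ∀ n → IsEnumeration (permutationSetoid n) (permutations n)
permutations-complete zero    π = here (λ ())
permutations-complete (suc n) π =
  ∈-resp-≈ (permutationSetoid (suc n))
    {x = insert zero (π ⟨$⟩ʳ zero) (remove zero π)} {y = π}
    (insert-remove zero π)
    (∈-cartesianProductWith⁺
      (setoid (Fin (suc n))) (permutationSetoid n) (permutationSetoid (suc n))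
      (λ {j} {k} {π₁} {π₂} → insert-cong {π = π₁} {ρ = π₂})
      (∈-allFin (π ⟨$⟩ʳ zero))
      (permutations-complete n (remove zero π)))

permutations-distinct : ∀ n → Unique (permutationSetoid n) (permutations n)
permutations-distinct zero    = [] ∷ []
permutations-distinct (suc n) =
  cartesianProductWith⁺
    (setoid (Fin (suc n))) (permutationSetoid n) (permutationSetoid (suc n))
    (insert zero)
    (λ {j} {k} {π} {ρ} → insert-injective {π = π} {ρ = ρ})
    (allFin⁺ (suc n))
    (permutations-distinct n)

uniformPermutation : ℕ → UniformSpace 0ℓ 0ℓ
uniformPermutation n = record
  { outcome  = permutationSetoid n
  ; outcomes = permutations n
  ; complete = permutations-complete n
  ; distinct = permutations-distinct n
  ; nonEmpty = >-nonZero
      (∈-length (permutationSetoid n) {x = Perm.id}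
        (permutations-complete n Perm.id))
  }

module _ {a ℓ₁ ℓ₂ : Level} (O : StrictTotalOrder a ℓ₁ ℓ₂) where
  open StrictTotalOrder O using (Carrier; _<?_)

  -- The set S is given by a labelling of its items by Fin N; the arrival order
  -- determined by π lists the items as item (π 0), item (π 1), …
  arrival : ∀ {N} → (Fin N → Carrier) → Permutation′ N → Fin N → Carrier
  arrival item π k = item (π ⟨$⟩ʳ k)

  comparisonBit : Carrier → Carrier → Bit
  comparisonBit x y = if does (x <? y) then 1b else 0b

  -- Positions are numbered from 0, so the items I₁ and I₂ are at 0F and 1F.
  arrivalBit : ∀ {N} → 2 ≤ N → (Fin N → Carrier) →
               UniformSpace.RandomVariable (uniformPermutation N) Bit
  arrivalBit 2≤N item = record
    { to   = λ π → comparisonBit (arrival item π (inject≤ 0F 2≤N))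
                                 (arrival item π (inject≤ 1F 2≤N))
    ; cong = λ π≈ρ → cong₂ comparisonBit (cong item (π≈ρ (inject≤ 0F 2≤N)))
                                         (cong item (π≈ρ (inject≤ 1F 2≤N)))
    }

{-# OPTIONS --safe #-}

-- Exchanging the first two arrivals is a bijection on the arrival orders that
-- flips the bit, so both values of the bit are taken equally often.
module Submission where

open import Defs
open import Data.Digit using (Bit; 0b; 1b)
open import Data.Fin.Base using (Fin; zero; suc; opposite)
open import Data.Fin.Patterns using (0F; 1F)
open import Data.Fin.Permutation as Perm
  using (Permutation′; _⟨$⟩ʳ_; _⟨$⟩ˡ_; _∘ₚ_; transpose; inverseʳ)
open import Data.Fin.Properties using (_≟_; injective⇒≤)
import Data.Integer.Base as ℤ
import Data.Integer.Properties as ℤ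
open import Data.List.Base using (List; []; _∷_; length; filter; lookup)
import Data.List.Membership.Setoid as Membership
open import Data.List.Membership.Propositional.Properties using (∈-lookup)
open import Data.List.Membership.Setoid.Properties using (∈-filter⁺; index-injective)
open import Data.List.Relation.Unary.All as All using (All)
open import Data.List.Relation.Unary.All.Properties using (all-filter)
open import Data.List.Relation.Unary.AllPairs.Core using (_∷_)
open import Data.List.Relation.Unary.Unique.Setoid using (Unique)
open import Data.List.Relation.Unary.Unique.Setoid.Properties using (filter⁺)
open import Data.Nat.Base using (ℕ; suc; _+_; _*_; _≤_; z≤n; s≤s; NonZero)
open import Data.Nat.Properties using (≤-antisym; +-suc; *-comm; +-identityʳ)
open import Data.Product.Base using (_×_; _,_)
open import Data.Rational.Base using (½; _/_)
open import Data.Rational.Properties using (fromℚᵘ-cong)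
open import Data.Rational.Unnormalised.Base using (mkℚᵘ; *≡*)
open import Function.Base using (_∘_)
open import Function.Bundles using (Func; Injection)
open import Function.Definitions using (Injective)
open import Function.Properties.Inverse using (↔⇒↣)
open import Level using (Level)
open import Relation.Binary.Bundles using (Setoid; StrictTotalOrder)
open import Relation.Binary.Definitions using (tri<; tri≈; tri>)
open import Relation.Binary.PropositionalEquality
  using (_≡_; _≢_; refl; sym; trans; cong; subst; module ≡-Reasoning)
open import Relation.Nullary.Decidable using (dec-true; dec-false)
open import Relation.Nullary.Negation using (¬_; contradiction)

-- Precomposing an arrival order with the transposition of positions 0 and 1 swaps `I₁` and `I₂`.
-- The items are distinct, so by trichotomy this negates the bit. It thus embeds each of the events
-- `b = 1`, `b = 0` into the other, which makes them equinumerous. They partition the outcomes, so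
-- each has probability one half. Orders are compared only up to pointwise equality, so the counting
-- goes through positions in duplicate-free lists.

private
  variable
    a ℓ ℓ₁ ℓ₂ : Level

module _ (S : Setoid a ℓ) where
  open Setoid S using (_≈_) renaming (Carrier to A; sym to ≈-sym)
  open Membership S using (_∈_)

  lookup-injective : ∀ {xs} → Unique S xs → ∀ i j → lookup xs i ≈ lookup xs j → i ≡ j
  lookup-injective (x# ∷ xs!) zero    zero    eq = refl
  lookup-injective (x# ∷ xs!) zero    (suc j) eq =
    contradiction eq (All.lookup x# (∈-lookup j))
  lookup-injective (x# ∷ xs!) (suc i) zero    eq =
    contradiction (≈-sym eq) (All.lookup x# (∈-lookup i))
  lookup-injective (x# ∷ xs!) (suc i) (suc j) eq =
    cong suc (lookup-injective xs! i j eq)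

  -- Pigeonhole on indices: sending a position of `x` in `xs` to the position of `f x` in `ys` is an
  -- injection between the two `Fin` types.
  injective⇒length≤ : ∀ {xs ys} {f : A → A} → Unique S xs → Injective _≈_ _≈_ f →
                      All (λ x → f x ∈ ys) xs → length xs ≤ length ys
  injective⇒length≤ {xs} xs! f-inj f∈ys = injective⇒≤ λ {i} {j} eq →
    lookup-injective xs! i j
      (f-inj (index-injective S (All.lookup f∈ys (∈-lookup i))
                                (All.lookup f∈ys (∈-lookup j)) eq))

length-filter-bits : {A : Set a} (X : A → Bit) (xs : List A) →
  length (filter (λ x → X x ≟ 1b) xs) + length (filter (λ x → X x ≟ 0b) xs) ≡ length xs
length-filter-bits X []       = refl
length-filter-bits X (x ∷ xs) with X x
... | 0F = trans (+-suc _ _) (cong suc (length-filter-bits X xs))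
... | 1F = cong suc (length-filter-bits X xs)

m/[m+m]≡½ : ∀ m {n} .{{_ : NonZero n}} → m + m ≡ n → ℤ.+ m / n ≡ ½
-- `mkℚᵘ` stores the denominator minus one, so these are m/(n+1) and 1/2; the chain is their
-- cross-multiplication.
m/[m+m]≡½ m {suc n} m+m≡n = fromℚᵘ-cong {mkℚᵘ (ℤ.+ m) n} {mkℚᵘ (ℤ.+ 1) 1} (*≡* (begin
  ℤ.+ m ℤ.* ℤ.+ 2      ≡⟨ ℤ.pos-* m 2 ⟨
  ℤ.+ (m * 2)          ≡⟨ cong ℤ.+_ (*-comm m 2) ⟩
  ℤ.+ (m + (m + 0))    ≡⟨ cong (λ k → ℤ.+ (m + k)) (+-identityʳ m) ⟩
  ℤ.+ (m + m)          ≡⟨ cong ℤ.+_ m+m≡n ⟩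
  ℤ.+ suc n            ≡⟨ ℤ.*-identityˡ (ℤ.+ suc n) ⟨
  ℤ.+ 1 ℤ.* ℤ.+ suc n  ∎))
  where open ≡-Reasoning

module _ (Ω : UniformSpace a ℓ) where
  open UniformSpace Ω
  open Setoid outcome using (_≈_) renaming (Carrier to Outcome)

  flip⇒unbiased : (X : RandomVariable Bit) (f : Outcome → Outcome) →
    Injective _≈_ _≈_ f → (∀ ω → Func.to X (f ω) ≡ opposite (Func.to X ω)) →
    Pr[ X ≡ 1b ] ≡ ½ × Pr[ X ≡ 0b ] ≡ ½
  flip⇒unbiased X f f-inj flips =
    m/[m+m]≡½ (count 1b) {{nonEmpty}}
      (trans (cong (count 1b +_) count₁≡count₀) total) ,
    m/[m+m]≡½ (count 0b) {{nonEmpty}}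
      (trans (cong (_+ count 0b) (sym count₁≡count₀)) total)
    where
    event : Bit → List Outcome
    event v = filter (λ ω → Func.to X ω ≟ v) outcomes

    count : Bit → ℕ
    count v = length (event v)

    count≤count-opposite : ∀ v → count v ≤ count (opposite v)
    count≤count-opposite v = injective⇒length≤ outcome
      (filter⁺ outcome (λ ω → Func.to X ω ≟ v) distinct) f-inj
      (All.map
        (λ {ω} X≡v → ∈-filter⁺ outcome (λ ω → Func.to X ω ≟ opposite v)
          -- The event respects the equality of outcomes because `X` does.
          (λ ω≈ω′ → trans (sym (Func.cong X ω≈ω′)))
          (complete (f ω)) (trans (flips ω) (cong opposite X≡v)))
        (all-filter (λ ω → Func.to X ω ≟ v) outcomes))

    count₁≡count₀ : count 1b ≡ count 0b
    -- `opposite` on `Fin 2` computes to negation, so the two instances are converse inequalities.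
    count₁≡count₀ = ≤-antisym (count≤count-opposite 1b) (count≤count-opposite 0b)

    total : count 1b + count 0b ≡ length outcomes
    total = length-filter-bits (Func.to X) outcomes

-- `σ` acts first in `σ ∘ₚ π`, so evaluating at the preimage of `i` under `σ` cancels it.
∘ₚ-injectiveʳ : ∀ {n} (σ : Permutation′ n) {π ρ : Permutation′ n} →
                σ ∘ₚ π Perm.≈ σ ∘ₚ ρ → π Perm.≈ ρ
∘ₚ-injectiveʳ σ {π} {ρ} eq i =
  subst (λ k → π ⟨$⟩ʳ k ≡ ρ ⟨$⟩ʳ k) (inverseʳ σ) (eq (σ ⟨$⟩ˡ i))

module _ (O : StrictTotalOrder a ℓ₁ ℓ₂) where
  open StrictTotalOrder O using (_≈_; _<?_; compare)

  comparisonBit-swap : ∀ {x y} → ¬ x ≈ y →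
                       comparisonBit O y x ≡ opposite (comparisonBit O x y)
  comparisonBit-swap {x} {y} x≉y with compare x y
  -- `x <? y` is computed from `compare x y`, so only the reversed test remains to be decided.
  ... | tri< _ _ y≮x rewrite dec-false (y <? x) y≮x = refl
  ... | tri≈ _ x≈y _ = contradiction x≈y x≉y
  ... | tri> _ _ y<x rewrite dec-true (y <? x) y<x = refl

theorem2 : {a ℓ₁ ℓ₂ : Level} (O : StrictTotalOrder a ℓ₁ ℓ₂) →
    (N : ℕ) (2≤N : 2 ≤ N) →
    (item : Fin N → StrictTotalOrder.Carrier O) →
    Injective _≡_ (StrictTotalOrder._≈_ O) item →
    let open UniformSpace (uniformPermutation N) in
    Pr[ arrivalBit O 2≤N item ≡ 1b ] ≡ ½ × Pr[ arrivalBit O 2≤N item ≡ 0b ] ≡ ½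
theorem2 O N@(suc (suc _)) 2≤N@(s≤s (s≤s z≤n)) item item-inj =
  flip⇒unbiased (uniformPermutation N) (arrivalBit O 2≤N item)
    (transpose 0F 1F ∘ₚ_)
    (λ {π} {ρ} → ∘ₚ-injectiveʳ (transpose 0F 1F) {π} {ρ})
    -- With `N` of the form `suc (suc _)`, the two positions and their transposition compute, so the
    -- flip is exactly the swap of the compared items.
    (λ π → comparisonBit-swap O (0≢1 π ∘ item-inj))
  where
  0≢1 : (π : Permutation′ N) → π ⟨$⟩ʳ 0F ≢ π ⟨$⟩ʳ 1F
  0≢1 π eq with () ← Injection.injective (↔⇒↣ π) eq
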